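{- Up to $\mathrm{S4}$-equivalence there are exactly six $\mathrm{S4}$-additive formulas without parameters (i.e. formulas in $\mathrm{Fm}(p)$): $\bot$, $p$, $\Diamond p$, $\top$, $\Diamond\Box\Diamond p$, and $\Diamond\Box\Diamond p\vee p$. Exactly five of them (all except $\top$) are normal in $\mathrm{S4}$.
   Context: $\mathrm{Fm}(p)$ is the set of modal formulas (built with Boolean connectives, $\bot,\top,\Diamond,\Box$) containing no variables other than $p$. For a normal modal logic $\Lambda$, formulas $\varphi,\psi$ are $\Lambda$-equivalent if $\Lambda\vdash\varphi\leftrightarrow\psi$. A formula $\varphi(p)$ is $\Lambda$-additive if $\Lambda\vdash\varphi(p\vee q)\leftrightarrow\varphi(p)\vee\varphi(q)$ (with $q$ a variable distinct from $p$), and normal in $\Lambda$ if $\Lambda\vdash\varphi(\bot)\leftrightarrow\bot$. $\mathrm{S4}$ is the usual normal modal logic of reflexive transitive frames. -}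

module Defs where

open import Level using (0ℓ)
open import Data.Bool using (Bool; true; false; not; _∨_; if_then_else_)
open import Data.Nat using (ℕ; _≟_)
open import Data.Vec using (Vec; _∷_; [])
open import Relation.Nullary using (does)
open import Relation.Unary using (Pred; _∈_; _⊆_)
open import Relation.Binary.PropositionalEquality using (_≡_; refl; trans; cong₂)

infix  10 ¬ᶠ_ □_ ◇_
infixr 8 _∧ᶠ_
infixr 7 _∨ᶠ_
infixr 6 _⇒_
infix  5 _⇔ᶠ_
infix  11 _[_/_]

Var : Set
Var = ℕ

-- The remaining classical connectives are the usual abbreviations.
data Formula : Set where
  var : Var → Formula
  ⊥ᶠ  : Formula
  _⇒_ : Formula → Formula → Formula
  □_  : Formula → Formula

¬ᶠ_ ◇_ : Formula → Formula
¬ᶠ φ = φ ⇒ ⊥ᶠ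
◇ φ = ¬ᶠ □ ¬ᶠ φ

⊤ᶠ : Formula
⊤ᶠ = ¬ᶠ ⊥ᶠ

_∨ᶠ_ _∧ᶠ_ _⇔ᶠ_ : Formula → Formula → Formula
φ ∨ᶠ ψ = ¬ᶠ φ ⇒ ψ
φ ∧ᶠ ψ = ¬ᶠ (φ ⇒ ¬ᶠ ψ)
φ ⇔ᶠ ψ = (φ ⇒ ψ) ∧ᶠ (ψ ⇒ φ)

data Fm (p : Var) : Pred Formula 0ℓ where
  var : var p ∈ Fm p
  ⊥ᶠ  : ⊥ᶠ ∈ Fm p
  _⇒_ : ∀ {φ ψ} → φ ∈ Fm p → ψ ∈ Fm p → (φ ⇒ ψ) ∈ Fm p
  □_  : ∀ {φ} → φ ∈ Fm p → (□ φ) ∈ Fm p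

substitute : (Var → Formula) → Formula → Formula
substitute σ (var x) = σ x
substitute σ ⊥ᶠ      = ⊥ᶠ
substitute σ (φ ⇒ ψ) = substitute σ φ ⇒ substitute σ ψ
substitute σ (□ φ)   = □ substitute σ φ

_[_/_] : Formula → Formula → Var → Formula
φ [ ψ / p ] = substitute (λ x → if does (x ≟ p) then ψ else var x) φ

-- Variables and boxed formulas both count as propositional atoms.
eval : (Formula → Bool) → Formula → Bool
eval v (var x) = v (var x)
eval v ⊥ᶠ      = false
eval v (φ ⇒ ψ) = not (eval v φ) ∨ eval v ψ
eval v (□ φ)   = v (□ φ)

Tautology : Pred Formula 0ℓ
Tautology φ = ∀ v → eval v φ ≡ true

Logic : Set₁
Logic = Pred Formula 0ℓ

record IsNormalModalLogic (Λ : Logic) : Set where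
  field
    taut : ∀ {φ} → Tautology φ → φ ∈ Λ
    K    : ∀ {φ ψ} → (□ (φ ⇒ ψ) ⇒ □ φ ⇒ □ ψ) ∈ Λ
    mp   : ∀ {φ ψ} → (φ ⇒ ψ) ∈ Λ → φ ∈ Λ → ψ ∈ Λ
    nec  : ∀ {φ} → φ ∈ Λ → (□ φ) ∈ Λ
    sub  : ∀ σ {φ} → φ ∈ Λ → substitute σ φ ∈ Λ

-- The least normal modal logic containing the reflexivity axiom T and the
-- transitivity axiom 4.  The axioms are schemes, so closure under substitution
-- is derived (S4-isNormal) instead of being a rule.
data S4 : Logic where
  taut : ∀ {φ} → Tautology φ → φ ∈ S4
  K    : ∀ {φ ψ} → (□ (φ ⇒ ψ) ⇒ □ φ ⇒ □ ψ) ∈ S4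
  T    : ∀ {φ} → (□ φ ⇒ φ) ∈ S4
  four : ∀ {φ} → (□ φ ⇒ □ □ φ) ∈ S4
  mp   : ∀ {φ ψ} → (φ ⇒ ψ) ∈ S4 → φ ∈ S4 → ψ ∈ S4
  nec  : ∀ {φ} → φ ∈ S4 → (□ φ) ∈ S4

eval-substitute : ∀ σ v φ →
  eval v (substitute σ φ) ≡ eval (λ χ → eval v (substitute σ χ)) φ
eval-substitute σ v (var x) = refl
eval-substitute σ v ⊥ᶠ      = refl
eval-substitute σ v (φ ⇒ ψ) =
  cong₂ (λ a b → not a ∨ b) (eval-substitute σ v φ) (eval-substitute σ v ψ)
eval-substitute σ v (□ φ)   = refl

S4-substitute : ∀ σ {φ} → φ ∈ S4 → substitute σ φ ∈ S4
S4-substitute σ {φ} (taut t) = taut λ v → trans (eval-substitute σ v φ) (t _)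
S4-substitute σ K            = K
S4-substitute σ T            = T
S4-substitute σ four         = four
S4-substitute σ (mp d e)     = mp (S4-substitute σ d) (S4-substitute σ e)
S4-substitute σ (nec d)      = nec (S4-substitute σ d)

S4-isNormal : IsNormalModalLogic S4
S4-isNormal = record
  { taut = taut ; K = K ; mp = mp ; nec = nec ; sub = S4-substitute }

S4-least : ∀ {Λ} → IsNormalModalLogic Λ →
  (∀ {φ} → (□ φ ⇒ φ) ∈ Λ) → (∀ {φ} → (□ φ ⇒ □ □ φ) ∈ Λ) → S4 ⊆ Λ
S4-least {Λ} N t f = go
  where
  module N = IsNormalModalLogic N
  go : S4 ⊆ Λ
  go (taut x) = N.taut x
  go K        = N.K
  go T        = t
  go four     = f
  go (mp d e) = N.mp (go d) (go e)
  go (nec d)  = N.nec (go d)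

Equivalent : Logic → Formula → Formula → Set
Equivalent Λ φ ψ = (φ ⇔ᶠ ψ) ∈ Λ

-- Meant for φ ∈ Fm p and q ≢ p, so that q does not occur in φ.
Additive : Logic → (p q : Var) → Formula → Set
Additive Λ p q φ = Equivalent Λ (φ [ var p ∨ᶠ var q / p ]) (φ ∨ᶠ φ [ var q / p ])

NormalIn : Logic → (p : Var) → Formula → Set
NormalIn Λ p φ = Equivalent Λ (φ [ ⊥ᶠ / p ]) ⊥ᶠ

sixFormulas : Var → Vec Formula 6
sixFormulas p =
    ⊥ᶠ
  ∷ var p
  ∷ ◇ var p
  ∷ ⊤ᶠ
  ∷ ◇ □ ◇ var p
  ∷ (◇ □ ◇ var p) ∨ᶠ var p
  ∷ []

{-# OPTIONS --safe #-}

-- Replace every world by a two-element cluster: a formula becomes a pair of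
-- formulas, one for each copy, and S4 stays sound.  An additive φ therefore also
-- distributes over sets that contain only one copy of each world satisfying p, and
-- such a set can be definably bisimilar to a valuation on a fixed six-world frame
-- where p is true at one or two worlds.  The truth value of φ there decides
-- whether a certain formula implies φ or refutes it.  Five such values determine
-- φ up to equivalence, and the six formulas realise all possible outcomes; neither
-- completeness nor the finite model property of S4 is needed.
module Submission where

open import Data.Bool using (Bool; true; false; not; _∨_; _∧_; if_then_else_)
  renaming (T to IsTrue)
open import Data.Bool.Properties using (T-≡; T-∧)
open import Data.Fin using (Fin; toℕ)
open import Data.Fin.Patterns
open import Data.Nat using (ℕ; zero; suc; _≟_)
open import Data.Product using (_×_; ∃; _,_; proj₁; proj₂; ∃-syntax)
open import Data.Sum using (_⊎_; inj₁; inj₂)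
open import Data.Vec as Vec using (Vec; lookup; []; _∷_; tabulate)
open import Data.Vec.N-ary
open import Function using (_∘_)
open import Function.Bundles using (_⇔_; mk⇔; Equivalence)
open import Relation.Nullary using (does; contradiction)
open import Relation.Nullary.Decidable using (dec-true; dec-false)
open import Relation.Unary using (_∈_)
open import Relation.Binary.PropositionalEquality
  using (_≡_; _≢_; refl; sym; trans; cong; cong₂; subst)
open import Defs

private variable
  n : ℕ
  α β γ δ φ ψ : Formula

-- Classical propositional reasoning by truth tables

-- Boxed formulas are excluded because `eval` treats them as atoms, and a truth-table row fixes the
-- values of variables only.
propositional : Formula → Bool
propositional (var x) = true
propositional ⊥ᶠ      = true
propositional (φ ⇒ ψ) = propositional φ ∧ propositional ψ
propositional (□ φ)   = false

eval-cong : ∀ {v w} φ → IsTrue (propositional φ) → (∀ x → v (var x) ≡ w (var x)) →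
  eval v φ ≡ eval w φ
eval-cong (var x) _ v≗w = v≗w x
eval-cong ⊥ᶠ      _ v≗w = refl
eval-cong (φ ⇒ ψ) b v≗w with b₁ , b₂ ← Equivalence.to T-∧ b =
  cong₂ (λ a b → not a ∨ b) (eval-cong φ b₁ v≗w) (eval-cong ψ b₂ v≗w)

instantiate : Vec Formula n → Var → Formula
instantiate []       x       = ⊥ᶠ
instantiate (α ∷ αs) zero    = α
instantiate (α ∷ αs) (suc x) = instantiate αs x

row : Vec Bool n → Formula → Bool
row bs (var x) = go bs x
  where
  go : Vec Bool n → Var → Bool
  go []       x       = false
  go (b ∷ bs) zero    = b
  go (b ∷ bs) (suc x) = go bs x
row bs _ = false

eval-instantiate : ∀ v (αs : Vec Formula n) x →
  eval v (instantiate αs x) ≡ row (Vec.map (eval v) αs) (var x)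
eval-instantiate v []       x       = refl
eval-instantiate v (α ∷ αs) zero    = refl
eval-instantiate v (α ∷ αs) (suc x) = eval-instantiate v αs x

allRows : ∀ n → (Vec Bool n → Bool) → Bool
allRows zero    f = f []
allRows (suc n) f = allRows n (f ∘ (true ∷_)) ∧ allRows n (f ∘ (false ∷_))

allRows-sound : ∀ {f : Vec Bool n → Bool} → IsTrue (allRows n f) → ∀ bs → f bs ≡ true
allRows-sound t [] = Equivalence.to T-≡ t
allRows-sound t (true ∷ bs)  = allRows-sound (proj₁ (Equivalence.to T-∧ t)) bs
allRows-sound t (false ∷ bs) = allRows-sound (proj₂ (Equivalence.to T-∧ t)) bs

schema : ∀ n → N-ary n Formula Formula → Formula
schema n f = f $ⁿ tabulate {n = n} (var ∘ toℕ)

-- For a concrete schema the implicit check computes to the unit type and is solved automatically.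
-- The instantiating formulas are implicit too, so that they are inferred from the goal.
tautology : ∀ n (f : N-ary n Formula Formula) →
  {IsTrue (propositional (schema n f) ∧ allRows n (λ bs → eval (row bs) (schema n f)))} →
  ∀ⁿʰ n (curryⁿ λ αs → substitute (instantiate αs) (schema n f) ∈ S4)
tautology n f {t} = hide n λ αs → taut λ v →
  trans (eval-substitute (instantiate αs) v (schema n f))
    (trans (eval-cong (schema n f) (proj₁ t′) (eval-instantiate v αs))
      (allRows-sound (proj₂ t′) (Vec.map (eval v) αs)))
  where
  t′ = Equivalence.to T-∧ t
  hide : ∀ n {P : Vec Formula n → Set} → (∀ αs → P αs) → ∀ⁿʰ n (curryⁿ P)
  hide zero    h = h []
  hide (suc n) h {α} = hide n (h ∘ (α ∷_))

infixl 5 _·_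
_·_ : (φ ⇒ ψ) ∈ S4 → φ ∈ S4 → ψ ∈ S4
_·_ = mp

infix 3 _⊢_
_⊢_ : Formula → Formula → Set
φ ⊢ ψ = (φ ⇒ ψ) ∈ S4

infixr 4 _⨾_
_⨾_ : α ⊢ β → β ⊢ γ → α ⊢ γ
d ⨾ e = tautology 3 (λ a b c → (a ⇒ b) ⇒ (b ⇒ c) ⇒ a ⇒ c) · d · e

⊢-refl : α ⊢ α
⊢-refl = tautology 1 λ a → a ⇒ a

weaken : α ∈ S4 → γ ⊢ α
weaken d = tautology 2 (λ a c → a ⇒ c ⇒ a) · d

⊥⊢ : ⊥ᶠ ⊢ α
⊥⊢ = tautology 1 λ a → ⊥ᶠ ⇒ a

⊢⊤ : α ⊢ ⊤ᶠ
⊢⊤ = weaken ⊢-refl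

⊢-∧ : γ ⊢ α → γ ⊢ β → γ ⊢ α ∧ᶠ β
⊢-∧ d e = tautology 3 (λ c a b → (c ⇒ a) ⇒ (c ⇒ b) ⇒ c ⇒ a ∧ᶠ b) · d · e

∧-fst : α ∧ᶠ β ⊢ α
∧-fst = tautology 2 λ a b → a ∧ᶠ b ⇒ a

∧-snd : α ∧ᶠ β ⊢ β
∧-snd = tautology 2 λ a b → a ∧ᶠ b ⇒ b

∨-inl : α ⊢ α ∨ᶠ β
∨-inl = tautology 2 λ a b → a ⇒ a ∨ᶠ b

∨-inr : β ⊢ α ∨ᶠ β
∨-inr = tautology 2 λ a b → b ⇒ a ∨ᶠ b

∨-⊢ : α ⊢ γ → β ⊢ γ → α ∨ᶠ β ⊢ γ
∨-⊢ d e = tautology 3 (λ a b c → (a ⇒ c) ⇒ (b ⇒ c) ⇒ a ∨ᶠ b ⇒ c) · d · e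

contra : α ⊢ β → ¬ᶠ β ⊢ ¬ᶠ α
contra d = tautology 2 (λ a b → (a ⇒ b) ⇒ ¬ᶠ b ⇒ ¬ᶠ a) · d

⇔-intro : α ⊢ β → β ⊢ α → Equivalent S4 α β
⇔-intro d e = tautology 2 (λ a b → (a ⇒ b) ⇒ (b ⇒ a) ⇒ (a ⇔ᶠ b)) · d · e

⇔-to : Equivalent S4 α β → α ⊢ β
⇔-to d = tautology 2 (λ a b → (a ⇔ᶠ b) ⇒ a ⇒ b) · d

⇔-from : Equivalent S4 α β → β ⊢ α
⇔-from d = tautology 2 (λ a b → (a ⇔ᶠ b) ⇒ b ⇒ a) · d

-- Modal reasoning in S4

□-mono : α ⊢ β → □ α ⊢ □ β
□-mono d = K · nec d

◇-mono : α ⊢ β → ◇ α ⊢ ◇ β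
◇-mono d = contra (□-mono (contra d))

◇-intro : α ⊢ ◇ α
◇-intro = tautology 2 (λ a b → (b ⇒ ¬ᶠ a) ⇒ a ⇒ ¬ᶠ b) · T

¬◇ : ¬ᶠ ◇ α ⊢ □ ¬ᶠ α
¬◇ = tautology 1 λ a → ¬ᶠ ¬ᶠ a ⇒ a

◇◇ : ◇ ◇ α ⊢ ◇ α
◇◇ = contra (four ⨾ □-mono (tautology 1 λ a → a ⇒ ¬ᶠ ¬ᶠ a))

-- A `γ` with `γ ⊢ □ γ` persists at all later worlds, so it can serve as a context under modalities.
□-stable-intro : γ ⊢ □ γ → γ ⊢ α → γ ⊢ □ α
□-stable-intro s d = s ⨾ □-mono d

□-under : γ ⊢ □ γ → γ ⊢ α ⇒ β → γ ⊢ □ α ⇒ □ β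
□-under s d = □-stable-intro s d ⨾ K

⊤-stable : ⊤ᶠ ⊢ □ ⊤ᶠ
⊤-stable = weaken (nec ⊢-refl)

◇-under : γ ⊢ □ γ → γ ⊢ α ⇒ β → γ ⊢ ◇ α ⇒ ◇ β
◇-under s d =
  □-under s (d ⨾ tautology 2 λ a b → (a ⇒ b) ⇒ ¬ᶠ b ⇒ ¬ᶠ a)
    ⨾ tautology 2 λ a b → (a ⇒ b) ⇒ ¬ᶠ b ⇒ ¬ᶠ a

-- Every world is replaced by a two-element cluster

Pair : Set
Pair = Fin 2 → Formula

⟨_,_⟩ : Formula → Formula → Pair
⟨ α , β ⟩ 0F = α
⟨ α , β ⟩ 1F = β

-- Both copies of a world see both copies of each successor, so the box clause does not depend on
-- `i`.
double : (Var → Pair) → Formula → Pair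
double ρ (var x) i = ρ x i
double ρ ⊥ᶠ      i = ⊥ᶠ
double ρ (φ ⇒ ψ) i = double ρ φ i ⇒ double ρ ψ i
double ρ (□ φ)   i = □ (double ρ φ 0F ∧ᶠ double ρ φ 1F)

eval-double : ∀ ρ v φ i →
  eval v (double ρ φ i) ≡ eval (λ χ → eval v (double ρ χ i)) φ
eval-double ρ v (var x) i = refl
eval-double ρ v ⊥ᶠ      i = refl
eval-double ρ v (φ ⇒ ψ) i =
  cong₂ (λ a b → not a ∨ b) (eval-double ρ v φ i) (eval-double ρ v ψ i)
eval-double ρ v (□ φ)   i = refl

∧-copy : ∀ (a : Pair) i → a 0F ∧ᶠ a 1F ⊢ a i
∧-copy a 0F = ∧-fst
∧-copy a 1F = ∧-snd

copies-∧ : ∀ {a : Pair} → (∀ i → γ ⊢ a i) → γ ⊢ a 0F ∧ᶠ a 1F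
copies-∧ h = ⊢-∧ (h 0F) (h 1F)

double-S4 : ∀ ρ {φ} → φ ∈ S4 → ∀ i → double ρ φ i ∈ S4
double-S4 ρ {φ} (taut t) i = taut λ v → trans (eval-double ρ v φ i) (t _)
double-S4 ρ K            i =
  □-mono (tautology 4 λ a b c d →
    (a ⇒ b) ∧ᶠ (c ⇒ d) ⇒ (a ∧ᶠ c) ⇒ (b ∧ᶠ d)) ⨾ K
double-S4 ρ (T {φ})      i = T ⨾ ∧-copy (double ρ φ) i
double-S4 ρ four         i = four ⨾ □-mono (⊢-∧ ⊢-refl ⊢-refl)
double-S4 ρ (mp d e)     i = double-S4 ρ d i · double-S4 ρ e i
double-S4 ρ (nec d)      i =
  nec (tautology 2 (λ a b → a ⇒ b ⇒ a ∧ᶠ b) · double-S4 ρ d 0F · double-S4 ρ d 1F)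

double-substitute : ∀ ρ σ φ i →
  double ρ (substitute σ φ) i ≡ double (double ρ ∘ σ) φ i
double-substitute ρ σ (var x) i = refl
double-substitute ρ σ ⊥ᶠ      i = refl
double-substitute ρ σ (φ ⇒ ψ) i =
  cong₂ _⇒_ (double-substitute ρ σ φ i) (double-substitute ρ σ ψ i)
double-substitute ρ σ (□ φ)   i =
  cong₂ (λ α β → □ (α ∧ᶠ β)) (double-substitute ρ σ φ 0F) (double-substitute ρ σ φ 1F)

double-agree : ∀ {p} {ρ ρ′ : Var → Pair} → φ ∈ Fm p → ρ p ≡ ρ′ p →
  ∀ i → double ρ φ i ≡ double ρ′ φ i
double-agree var     eq i = cong (λ a → a i) eq
double-agree ⊥ᶠ      eq i = refl
double-agree (f ⇒ g) eq i = cong₂ _⇒_ (double-agree f eq i) (double-agree g eq i)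
double-agree (□ f)   eq i =
  cong₂ (λ α β → □ (α ∧ᶠ β)) (double-agree f eq 0F) (double-agree f eq 1F)

-- All variables receive the same pair, which is harmless for formulas in `Fm p`.
⟦_⟧ : Formula → Pair → Pair
⟦ φ ⟧ a = double (λ _ → a) φ

⇒-cong : Equivalent S4 α β → Equivalent S4 γ δ → Equivalent S4 (α ⇒ γ) (β ⇒ δ)
⇒-cong d e = tautology 4 (λ a b c d →
  (a ⇔ᶠ b) ⇒ (c ⇔ᶠ d) ⇒ ((a ⇒ c) ⇔ᶠ (b ⇒ d))) · d · e

⟦⟧-cong : ∀ φ {a b : Pair} → (∀ i → Equivalent S4 (a i) (b i)) →
  ∀ i → Equivalent S4 (⟦ φ ⟧ a i) (⟦ φ ⟧ b i)
⟦⟧-cong (var x) h i = h i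
⟦⟧-cong ⊥ᶠ      h i = ⇔-intro ⊢-refl ⊢-refl
⟦⟧-cong (φ ⇒ ψ) h i = ⇒-cong (⟦⟧-cong φ h i) (⟦⟧-cong ψ h i)
⟦⟧-cong (□ φ) {a} {b} h i = ⇔-intro (□-mono (to 0F 1F)) (□-mono (from 0F 1F))
  where
  to : ∀ i j → ⟦ φ ⟧ a i ∧ᶠ ⟦ φ ⟧ a j ⊢ ⟦ φ ⟧ b i ∧ᶠ ⟦ φ ⟧ b j
  to i j = ⊢-∧ (∧-fst ⨾ ⇔-to (⟦⟧-cong φ h i)) (∧-snd ⨾ ⇔-to (⟦⟧-cong φ h j))
  from : ∀ i j → ⟦ φ ⟧ b i ∧ᶠ ⟦ φ ⟧ b j ⊢ ⟦ φ ⟧ a i ∧ᶠ ⟦ φ ⟧ a j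
  from i j = ⊢-∧ (∧-fst ⨾ ⇔-from (⟦⟧-cong φ h i)) (∧-snd ⨾ ⇔-from (⟦⟧-cong φ h j))

-- When the two copies of every world agree on `p`, doubling is invisible to formulas.
⟦⟧-collapse : ∀ {p} → φ ∈ Fm p → ∀ i → Equivalent S4 (⟦ φ ⟧ (λ _ → var p) i) φ
⟦⟧-collapse var     i = ⇔-intro ⊢-refl ⊢-refl
⟦⟧-collapse ⊥ᶠ      i = ⇔-intro ⊢-refl ⊢-refl
⟦⟧-collapse (f ⇒ g) i = ⇒-cong (⟦⟧-collapse f i) (⟦⟧-collapse g i)
⟦⟧-collapse (□ f)   i = ⇔-intro
  (□-mono (∧-fst ⨾ ⇔-to (⟦⟧-collapse f 0F)))
  (□-mono (⊢-∧ (⇔-from (⟦⟧-collapse f 0F)) (⇔-from (⟦⟧-collapse f 1F))))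

-- Additivity and monotonicity on pairs

substitute-at : ∀ p χ → (var p [ χ / p ]) ≡ χ
substitute-at p χ rewrite dec-true (p ≟ p) refl = refl

_∪_ : Pair → Pair → Pair
(a ∪ b) i = a i ∨ᶠ b i

module _ {p q φ} (p≢q : p ≢ q) (φ∈Fm : φ ∈ Fm p) (additive : Additive S4 p q φ) where

  -- The derivation of additivity is itself doubled, with `p` read as `a` and `q` as `b`.
  ⟦⟧-additive : ∀ a b i → Equivalent S4 (⟦ φ ⟧ (a ∪ b) i) (⟦ φ ⟧ a i ∨ᶠ ⟦ φ ⟧ b i)
  ⟦⟧-additive a b i = subst (_∈ S4)
    (cong₂ _⇔ᶠ_
      (at-substituted (var p ∨ᶠ var q) (a ∪ b) (cong₂ _∪_ ρp ρq))
      (cong₂ _∨ᶠ_ (double-agree φ∈Fm ρp i) (at-substituted (var q) b ρq)))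
    (double-S4 ρ additive i)
    where
    ρ : Var → Pair
    ρ x = if does (x ≟ p) then a else b
    ρp : ρ p ≡ a
    ρp rewrite dec-true (p ≟ p) refl = refl
    ρq : ρ q ≡ b
    ρq rewrite dec-false (q ≟ p) (p≢q ∘ sym) = refl
    at-substituted : ∀ χ c → double ρ χ ≡ c → double ρ (φ [ χ / p ]) i ≡ ⟦ φ ⟧ c i
    at-substituted χ c eq = trans (double-substitute ρ _ φ i)
      (double-agree φ∈Fm (trans (cong (double ρ) (substitute-at p χ)) eq) i)

  ⟦⟧-mono : ∀ {a b} → (∀ i → a i ⊢ b i) → ∀ i → ⟦ φ ⟧ a i ⊢ ⟦ φ ⟧ b i
  ⟦⟧-mono {a} {b} a⊢b i = ∨-inl
    ⨾ ⇔-from (⟦⟧-additive a b i)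
    ⨾ ⇔-to (⟦⟧-cong φ {a ∪ b} (λ i → ⇔-intro (∨-⊢ (a⊢b i) ⊢-refl) ∨-inr) i)

  ⟦⟧-below : ∀ {a} → (∀ i → a i ⊢ var p) → ∀ i → ⟦ φ ⟧ a i ⊢ φ
  ⟦⟧-below a⊢p i = ⟦⟧-mono a⊢p i ⨾ ⇔-to (⟦⟧-collapse φ∈Fm i)

  ⟦⟧-above : ∀ {a} → (∀ i → var p ⊢ a i) → ∀ i → φ ⊢ ⟦ φ ⟧ a i
  ⟦⟧-above p⊢a i = ⇔-from (⟦⟧-collapse φ∈Fm i) ⨾ ⟦⟧-mono p⊢a i

-- A frame with three two-element clusters, the lowest of which sees all worlds

data World : Set where
  root : Fin 2 → World
  top  : Fin 2 → Fin 2 → World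

data _≼_ : World → World → Set where
  root≼ : ∀ {i w} → root i ≼ w
  top≼  : ∀ {s i j} → top s i ≼ top s j

≼-refl : ∀ w → w ≼ w
≼-refl (root i)  = root≼
≼-refl (top s i) = top≼

≼-trans : ∀ {u v w} → u ≼ v → v ≼ w → u ≼ w
≼-trans root≼ _    = root≼
≼-trans top≼  top≼ = top≼

both : (Fin 2 → Bool) → Bool
both f = f 0F ∧ f 1F

box : (World → Bool) → World → Bool
box f (root _)  = both (f ∘ root) ∧ both (λ s → both (f ∘ top s))
box f (top s _) = both (f ∘ top s)

both-view : ∀ f → (both f ≡ true × ∀ i → f i ≡ true)
                ⊎ (both f ≡ false × ∃[ i ] f i ≡ false)
both-view f with f 0F in eq₀ | f 1F in eq₁
... | false | _     = inj₂ (refl , 0F , eq₀)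
... | true  | false = inj₂ (refl , 1F , eq₁)
... | true  | true  = inj₁ (refl , λ { 0F → eq₀ ; 1F → eq₁ })

box-view : ∀ f w → (box f w ≡ true × ∀ {v} → w ≼ v → f v ≡ true)
                 ⊎ (box f w ≡ false × ∃[ v ] w ≼ v × f v ≡ false)
box-view f (top s _) with both-view (f ∘ top s)
... | inj₁ (eq , h)     = inj₁ (eq , λ { top≼ → h _ })
... | inj₂ (eq , i , e) = inj₂ (eq , top s i , top≼ , e)
box-view f (root _) with both-view (f ∘ root) | both-view (λ s → both (f ∘ top s))
... | inj₂ (eq , i , e) | _ rewrite eq = inj₂ (refl , root i , root≼ , e)
... | inj₁ (eq , h) | inj₁ (eq′ , h′) rewrite eq | eq′ =
  inj₁ (refl , λ { {root i} _ → h i ; {top s i} _ → at-top s i })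
  where
  at-top : ∀ s i → f (top s i) ≡ true
  at-top s i with both-view (f ∘ top s)
  ... | inj₁ (_ , g)  = g i
  ... | inj₂ (e , _) with () ← trans (sym e) (h′ s)
... | inj₁ (eq , h) | inj₂ (eq′ , s , e) rewrite eq | eq′ with both-view (f ∘ top s)
...   | inj₁ (e′ , _)     with () ← trans (sym e) e′
...   | inj₂ (_ , i , e′) = inj₂ (refl , top s i , root≼ , e′)

box-elim : ∀ f w → box f w ≡ true → ∀ {v} → w ≼ v → f v ≡ true
box-elim f w b w≼v with box-view f w
... | inj₁ (_ , h) = h w≼v
... | inj₂ (e , _) with () ← trans (sym e) b

box-intro : ∀ f w → (∀ {v} → w ≼ v → f v ≡ true) → box f w ≡ true
box-intro f w h with box-view f w
... | inj₁ (b , _)             = b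
... | inj₂ (_ , _ , w≼v , e) with () ← trans (sym e) (h w≼v)

box-cong : ∀ {f g} → (∀ w → f w ≡ g w) → ∀ w → box f w ≡ box g w
box-cong {f} {g} f≗g w with box-view g w
... | inj₁ (b , h)           = trans (box-intro f w λ w≼v → trans (f≗g _) (h w≼v)) (sym b)
... | inj₂ (b , v , w≼v , e) with box-view f w
...   | inj₁ (_ , h) with () ← trans (sym e) (trans (sym (f≗g v)) (h w≼v))
...   | inj₂ (b′ , _) = trans b′ (sym b)

-- Soundness of S4 and additivity on the frame

force : (Var → World → Bool) → Formula → World → Bool
force V (var x) w = V x w
force V ⊥ᶠ      w = false
force V (φ ⇒ ψ) w = not (force V φ w) ∨ force V ψ w
force V (□ φ)   w = box (force V φ) w

force-eval : ∀ V φ w → force V φ w ≡ eval (λ χ → force V χ w) φ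
force-eval V (var x) w = refl
force-eval V ⊥ᶠ      w = refl
force-eval V (φ ⇒ ψ) w = cong₂ (λ a b → not a ∨ b) (force-eval V φ w) (force-eval V ψ w)
force-eval V (□ φ)   w = refl

⇒-true-intro : ∀ a {b} → (a ≡ true → b ≡ true) → not a ∨ b ≡ true
⇒-true-intro false h = refl
⇒-true-intro true  h = h refl

⇒-true-elim : ∀ a {b} → not a ∨ b ≡ true → a ≡ true → b ≡ true
⇒-true-elim true h refl = h

force-sound : ∀ V → φ ∈ S4 → ∀ w → force V φ w ≡ true
force-sound V (taut {φ} t) w = trans (force-eval V φ w) (t _)
force-sound V (K {φ} {ψ})  w =
  ⇒-true-intro (force V (□ (φ ⇒ ψ)) w) λ h → ⇒-true-intro (force V (□ φ) w) λ k →
    box-intro (force V ψ) w λ {v} w≼v → ⇒-true-elim (force V φ v)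
      (box-elim (force V (φ ⇒ ψ)) w h w≼v) (box-elim (force V φ) w k w≼v)
force-sound V (T {φ})      w =
  ⇒-true-intro (force V (□ φ) w) λ h → box-elim (force V φ) w h (≼-refl w)
force-sound V (four {φ})   w = ⇒-true-intro (force V (□ φ) w) λ h →
  box-intro (force V (□ φ)) w λ {u} w≼u → box-intro (force V φ) u λ u≼v →
    box-elim (force V φ) w h (≼-trans w≼u u≼v)
force-sound V (mp {φ} d e) w =
  ⇒-true-elim (force V φ w) (force-sound V d w) (force-sound V e w)
force-sound V (nec {φ} d)  w = box-intro (force V φ) w λ _ → force-sound V d _

force-substitute : ∀ V σ φ w →
  force V (substitute σ φ) w ≡ force (λ x → force V (σ x)) φ w
force-substitute V σ (var x) w = refl
force-substitute V σ ⊥ᶠ      w = refl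
force-substitute V σ (φ ⇒ ψ) w =
  cong₂ (λ a b → not a ∨ b) (force-substitute V σ φ w) (force-substitute V σ ψ w)
force-substitute V σ (□ φ)   w = box-cong (force-substitute V σ φ) w

force-agree : ∀ {p V V′} → φ ∈ Fm p → (∀ w → V p w ≡ V′ p w) →
  ∀ w → force V φ w ≡ force V′ φ w
force-agree var     eq w = eq w
force-agree ⊥ᶠ      eq w = refl
force-agree (f ⇒ g) eq w =
  cong₂ (λ a b → not a ∨ b) (force-agree f eq w) (force-agree g eq w)
force-agree (□ f)   eq w = box-cong (force-agree f eq) w

holds : Formula → (World → Bool) → World → Bool
holds φ A = force (λ _ → A) φ

holds-additive : ∀ {p q φ} → p ≢ q → φ ∈ Fm p → Additive S4 p q φ → ∀ A B w →
  holds φ (λ v → A v ∨ B v) w ≡ true → holds φ A w ≡ false → holds φ B w ≡ true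
holds-additive {p} {q} {φ} p≢q φ∈Fm additive A B w h ¬a =
  trans (sym (at-substituted (var q) B Vq))
    (⇒-true-elim (not (force V φ w) ∨ false)
      (⇒-true-elim (force V (φ [ var p ∨ᶠ var q / p ]) w) (force-sound V (⇔-to additive) w)
        (trans (at-substituted (var p ∨ᶠ var q) _ V∨) h))
      (cong (λ a → not a ∨ false) (trans (force-agree φ∈Fm Vp w) ¬a)))
  where
  V : Var → World → Bool
  V x = if does (x ≟ p) then A else B
  Vp : ∀ v → V p v ≡ A v
  Vp v rewrite dec-true (p ≟ p) refl = refl
  Vq : ∀ v → V q v ≡ B v
  Vq v rewrite dec-false (q ≟ p) (p≢q ∘ sym) = refl
  V∨ : ∀ v → force V (var p ∨ᶠ var q) v ≡ A v ∨ B v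
  V∨ v rewrite Vp v | Vq v with A v
  ... | true  = refl
  ... | false = refl
  at-substituted : ∀ χ C → (∀ v → force V χ v ≡ C v) →
    force V (φ [ χ / p ]) w ≡ holds φ C w
  at-substituted χ C eq = trans (force-substitute V _ φ w)
    (force-agree φ∈Fm (λ v → trans (cong (λ χ → force V χ v) (substitute-at p χ)) (eq v)) w)

-- Transfer from the frame to provability

sign : Bool → Formula → Formula
sign b φ = if b then φ else ¬ᶠ φ

-- θ w i describes the worlds whose copy i is related to w.  The θ w need not be
-- disjoint, and forth is a rule rather than a formula to avoid finite disjunctions.
record Bisimulation (A : World → Bool) (a : Pair) (θ : World → Pair) : Set where
  field
    atom  : ∀ w i → θ w i ⊢ sign (A w) (a i)
    forth : ∀ w i {b : Pair} → (∀ {v} → w ≼ v → ∀ j → θ v j ⊢ b j) →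
            θ w i ⊢ □ (b 0F ∧ᶠ b 1F)
    back  : ∀ {w v} i → w ≼ v → θ w i ⊢ ◇ (θ v 0F ∨ᶠ θ v 1F)

module _ {A a θ} (Z : Bisimulation A a θ) where
  open Bisimulation Z

  -- Invariance under bisimulation in provable form: a true box is carried over by `forth`, a false
  -- one by `back` towards a refuting world.
  transfer : ∀ φ w i → θ w i ⊢ sign (holds φ A w) (⟦ φ ⟧ a i)
  transfer (var x) w i = atom w i
  transfer ⊥ᶠ      w i = ⊢⊤
  transfer (φ ⇒ ψ) w i with holds φ A w | holds ψ A w | transfer φ w i | transfer ψ w i
  ... | false | _     | d | _ = d ⨾ tautology 2 λ a b → ¬ᶠ a ⇒ a ⇒ b
  ... | true  | true  | _ | e = e ⨾ tautology 2 λ a b → b ⇒ a ⇒ b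
  ... | true  | false | d | e = ⊢-∧ d e ⨾ tautology 2 λ a b → a ∧ᶠ ¬ᶠ b ⇒ ¬ᶠ (a ⇒ b)
  transfer (□ φ)   w i with box-view (holds φ A) w
  ... | inj₁ (eq , h) rewrite eq = forth w i λ {v} w≼v j →
    subst (λ b → θ v j ⊢ sign b (⟦ φ ⟧ a j)) (h w≼v) (transfer φ v j)
  ... | inj₂ (eq , v , w≼v , e) rewrite eq =
    back i w≼v ⨾ ◇-mono (∨-⊢ (refuted 0F ⨾ contra ∧-fst) (refuted 1F ⨾ contra ∧-snd))
      -- Unfolding `◇` of a negation leaves a double negation under the box, which is removed here.
      ⨾ contra (□-mono (tautology 1 λ a → a ⇒ ¬ᶠ ¬ᶠ a))
    where
    refuted : ∀ j → θ v j ⊢ ¬ᶠ ⟦ φ ⟧ a j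
    refuted j = subst (λ b → θ v j ⊢ sign b (⟦ φ ⟧ a j)) e (transfer φ v j)

flip : World → World
flip (root i)   = root i
flip (top 0F i) = top 1F i
flip (top 1F i) = top 0F i

flip-involutive : ∀ w → flip (flip w) ≡ w
flip-involutive (root i)   = refl
flip-involutive (top 0F i) = refl
flip-involutive (top 1F i) = refl

flip-mono : ∀ {w v} → w ≼ v → flip w ≼ flip v
flip-mono root≼       = root≼
flip-mono (top≼ {0F}) = top≼
flip-mono (top≼ {1F}) = top≼

-- `flip` is an automorphism of the frame that fixes the root worlds, so the mirrored valuation is
-- linked to the same pair by the same root formulas.
flip-bisimulation : ∀ {A a θ} → Bisimulation A a θ → Bisimulation (A ∘ flip) a (θ ∘ flip)
flip-bisimulation {θ = θ} Z = record
  { atom  = atom ∘ flip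
  ; forth = λ w i {b} h → forth (flip w) i λ {v} w≼v j →
      subst (λ u → θ u j ⊢ b j) (flip-involutive v)
        (h (subst (_≼ flip v) (flip-involutive w) (flip-mono w≼v)) j)
  ; back  = λ i w≼v → back i (flip-mono w≼v)
  }
  where open Bisimulation Z

transfer-true : ∀ {A a θ} → Bisimulation A a θ → ∀ φ w i →
  holds φ A w ≡ true → θ w i ⊢ ⟦ φ ⟧ a i
transfer-true {a = a} {θ} Z φ w i h =
  subst (λ b → θ w i ⊢ sign b (⟦ φ ⟧ a i)) h (transfer Z φ w i)

transfer-false : ∀ {A a θ} → Bisimulation A a θ → ∀ φ w i →
  holds φ A w ≡ false → θ w i ⊢ ¬ᶠ ⟦ φ ⟧ a i
transfer-false {a = a} {θ} Z φ w i h =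
  subst (λ b → θ w i ⊢ sign b (⟦ φ ⟧ a i)) h (transfer Z φ w i)

-- Bisimulations for the valuations used in the classification

constant-bisimulation : ∀ b {γ a} → γ ⊢ □ γ → (∀ i → γ ⊢ sign b (a i)) →
  Bisimulation (λ _ → b) a (λ _ _ → γ)
constant-bisimulation b s d = record
  { atom  = λ _ i → d i
  ; forth = λ w i h → □-stable-intro s (copies-∧ (h (≼-refl w)))
  ; back  = λ i _ → ∨-inl ⨾ ◇-intro
  }

-- Of crowd = leftPoint ∪ leftPoint ∘ flip, additivity selects one part without saying
-- which; the symmetry of the frame makes both equally good.
leftPoint crowd lowPoint : World → Bool
leftPoint (top 0F 0F) = true
leftPoint _           = false
crowd w = leftPoint w ∨ leftPoint (flip w)
lowPoint (root 0F) = true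
lowPoint _         = false

◇-keep : γ ⊢ □ γ → γ ⊢ α ⇒ ◇ β → γ ∧ᶠ α ⊢ ◇ (γ ∧ᶠ β)
◇-keep {γ} {α} {β} s d =
  tautology 4 (λ c a d e → (c ⇒ a ⇒ d) ⇒ (c ⇒ d ⇒ e) ⇒ c ∧ᶠ a ⇒ e) · d
    · ◇-under s (tautology 2 λ c b → c ⇒ b ⇒ c ∧ᶠ b)

∧-distrib-∨ : γ ∧ᶠ (α ∨ᶠ β) ⊢ (γ ∧ᶠ α) ∨ᶠ (γ ∧ᶠ β)
∧-distrib-∨ = tautology 3 λ c a b → c ∧ᶠ (a ∨ᶠ b) ⇒ (c ∧ᶠ a) ∨ᶠ (c ∧ᶠ b)

-- Every world of the frame sees both values of `crowd`, and under `γ` both values of `a` recur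
-- forever. Hence only the value at a world matters.
crowd-bisimulation : ∀ {γ} {a : Pair} → γ ⊢ □ γ →
  γ ⊢ ◇ (a 0F ∨ᶠ a 1F) → γ ⊢ ◇ (¬ᶠ a 0F ∨ᶠ ¬ᶠ a 1F) →
  Bisimulation crowd a (λ w i → γ ∧ᶠ sign (crowd w) (a i))
crowd-bisimulation {γ} {a} s hit miss = record
  { atom  = λ _ _ → ∧-snd
  ; forth = λ w i {b} h → ∧-fst ⨾ □-stable-intro s (copies-∧ λ j → covered (b j)
      (reach true w λ {v} w≼v eq →
        subst (λ c → γ ∧ᶠ sign c (a j) ⊢ b j) eq (h w≼v j))
      (reach false w λ {v} w≼v eq →
        subst (λ c → γ ∧ᶠ sign c (a j) ⊢ b j) eq (h w≼v j)))
  ; back  = λ {w} {v} i w≼v →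
      ◇-keep s (recur (crowd v) ⨾ tautology 2 λ d x → d ⇒ x ⇒ d)
      ⨾ ◇-mono ∧-distrib-∨
  }
  where
  covered : ∀ {α} β → γ ∧ᶠ α ⊢ β → γ ∧ᶠ ¬ᶠ α ⊢ β → γ ⊢ β
  covered β d e = tautology 3 (λ c a b →
    (c ∧ᶠ a ⇒ b) ⇒ (c ∧ᶠ ¬ᶠ a ⇒ b) ⇒ c ⇒ b) · d · e
  reach : ∀ c w {X : Set} → (∀ {v} → w ≼ v → crowd v ≡ c → X) → X
  reach true  (root _)   k = k {top 0F 0F} root≼ refl
  reach true  (top 0F _) k = k {top 0F 0F} top≼ refl
  reach true  (top 1F _) k = k {top 1F 0F} top≼ refl
  reach false (root _)   k = k {root 0F} root≼ refl
  reach false (top 0F _) k = k {top 0F 1F} top≼ refl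
  reach false (top 1F _) k = k {top 1F 1F} top≼ refl
  recur : ∀ c → γ ⊢ ◇ (sign c (a 0F) ∨ᶠ sign c (a 1F))
  recur true  = hit
  recur false = miss

-- The hypothesis forbids leaving e for worlds that no longer see it, so such worlds
-- lie above the root region only.
module LeftPoint {e} (stable : e ⊢ □ ◇ e) where
  u : Formula
  u = □ ◇ e
  θ : World → Pair
  -- The root region can still reach `e` but can also lose it; on the left `e` recurs forever, on
  -- the right it is lost. The second copy carries `⊥ᶠ`, so there the left region belongs entirely
  -- to the world outside `leftPoint`.
  θ (root _)   _ = ◇ e ∧ᶠ ◇ □ ¬ᶠ e
  θ (top 0F 0F)  = ⟨ e , ⊥ᶠ ⟩
  θ (top 0F 1F)  = ⟨ u ∧ᶠ ¬ᶠ e , u ⟩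
  θ (top 1F _) _ = □ ¬ᶠ e
  unseen⇒¬e : ∀ i → □ ¬ᶠ e ⊢ ¬ᶠ ⟨ e , ⊥ᶠ ⟩ i
  unseen⇒¬e 0F = T
  unseen⇒¬e 1F = ⊢⊤
  below⇒¬e : ∀ i → ◇ e ∧ᶠ ◇ □ ¬ᶠ e ⊢ ¬ᶠ ⟨ e , ⊥ᶠ ⟩ i
  below⇒¬e 0F = tautology 3 (λ e d u → (e ⇒ u) ⇒ d ∧ᶠ ¬ᶠ u ⇒ ¬ᶠ e) · stable
  below⇒¬e 1F = ⊢⊤
  atom : ∀ w i → θ w i ⊢ sign (leftPoint w) (⟨ e , ⊥ᶠ ⟩ i)
  atom (root i)    j  = below⇒¬e j
  atom (top 0F 0F) j  = ⊢-refl
  atom (top 0F 1F) 0F = ∧-snd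
  atom (top 0F 1F) 1F = ⊢⊤
  atom (top 1F i)  j  = unseen⇒¬e j
  θ⊢u : ∀ i j → θ (top 0F i) j ⊢ u
  θ⊢u 0F 0F = stable
  θ⊢u 0F 1F = ⊥⊢
  θ⊢u 1F 0F = ∧-fst
  θ⊢u 1F 1F = ⊢-refl
  from-u : ∀ {b : Pair} → (∀ i j → θ (top 0F i) j ⊢ b j) → ∀ j → u ⊢ b j
  from-u h 0F =
    tautology 3 (λ e u b → (e ⇒ b) ⇒ (u ∧ᶠ ¬ᶠ e ⇒ b) ⇒ u ⇒ b) · h 0F 0F · h 1F 0F
  from-u h 1F = h 1F 1F
  forth : ∀ w i {b : Pair} → (∀ {v} → w ≼ v → ∀ j → θ v j ⊢ b j) →
          θ w i ⊢ □ (b 0F ∧ᶠ b 1F)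
  forth (root i)   j h = weaken (nec (copies-∧ all · ⊢-refl))
    where
    all : ∀ j → ⊤ᶠ ⊢ _
    -- The three regions exhaust all worlds: `e` is unseen, or seen but losable, or not losable, and
    -- the last means `u`.
    all j = tautology 3 (λ n l b → (n ⇒ b) ⇒ (¬ᶠ n ∧ᶠ l ⇒ b) ⇒ (¬ᶠ l ⇒ b) ⇒ ⊤ᶠ ⇒ b)
      · h {top 1F 0F} root≼ j · h {root 0F} root≼ j
      · (¬◇ ⨾ from-u (λ i → h {top 0F i} root≼) j)
  forth (top 0F i) j h =
    θ⊢u i j ⨾ □-stable-intro four (copies-∧ (from-u λ i → h {top 0F i} top≼))
  forth (top 1F i) j h = □-stable-intro four (copies-∧ (h {top 1F 0F} top≼))
  back-e : ∀ i → ◇ e ⊢ ◇ (θ (top 0F i) 0F ∨ᶠ θ (top 0F i) 1F)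
  back-e 0F = ◇-mono ∨-inl
  back-e 1F = ◇-mono (stable ⨾ ∨-inr)
  back : ∀ {w v} i → w ≼ v → θ w i ⊢ ◇ (θ v 0F ∨ᶠ θ v 1F)
  back {root i} {root _}   j root≼ = ∨-inl ⨾ ◇-intro
  back {root i} {top 0F k} j root≼ = ∧-fst ⨾ back-e k
  back {root i} {top 1F k} j root≼ = ∧-snd ⨾ ◇-mono ∨-inl
  back {top 0F i} {top 0F k} j top≼ = θ⊢u i j ⨾ T ⨾ back-e k
  back {top 1F i} j top≼ = ∨-inl ⨾ ◇-intro

  bisimulation : Bisimulation leftPoint ⟨ e , ⊥ᶠ ⟩ θ
  bisimulation = record { atom = atom ; forth = forth ; back = back }

-- Under □ ◇ □ ¬ α, that is ¬ ◇ □ ◇ α, the worlds below α see worlds that do not.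
module LowPoint {α} {a : Pair} (below : ∀ i → a i ⊢ ◇ α)
  (hit : ◇ α ⊢ ◇ (a 0F ∨ᶠ a 1F)) (miss : ◇ α ⊢ ¬ᶠ (a 0F ∧ᶠ a 1F)) where
  κ : Formula
  κ = □ ◇ □ ¬ᶠ α
  θ : World → Pair
  -- Under `κ` a copy either satisfies `a`, or fails `a` while still seeing `α`, or no longer sees
  -- `α`. The last region serves for both top clusters.
  θ (root 0F) i = κ ∧ᶠ a i
  θ (root 1F) i = κ ∧ᶠ (◇ α ∧ᶠ ¬ᶠ a i)
  θ (top _ _) _ = □ ¬ᶠ α
  atom : ∀ w i → θ w i ⊢ sign (lowPoint w) (a i)
  atom (root 0F) j = ∧-snd
  atom (root 1F) j = ∧-snd ⨾ ∧-snd
  atom (top s i) j = tautology 2 (λ n a → (a ⇒ ¬ᶠ n) ⇒ n ⇒ ¬ᶠ a) · below j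
  θ⊢ : ∀ i j → θ (root i) j ⊢ κ ∧ᶠ ◇ α
  θ⊢ 0F j = ⊢-∧ ∧-fst (∧-snd ⨾ below j)
  θ⊢ 1F j = ⊢-∧ ∧-fst (∧-snd ⨾ ∧-fst)
  forth : ∀ w i {b : Pair} → (∀ {v} → w ≼ v → ∀ j → θ v j ⊢ b j) →
          θ w i ⊢ □ (b 0F ∧ᶠ b 1F)
  forth (root i)  j h = θ⊢ i j ⨾ ∧-fst ⨾ □-stable-intro four (copies-∧ λ j →
    tautology 4 (λ c a n b →
      (c ∧ᶠ a ⇒ b) ⇒ (c ∧ᶠ (¬ᶠ n ∧ᶠ ¬ᶠ a) ⇒ b) ⇒ (n ⇒ b) ⇒ c ⇒ b)
      · h {root 0F} root≼ j · h {root 1F} root≼ j · h {top 0F 0F} root≼ j)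
  forth (top s i) j h = □-stable-intro four (copies-∧ (h {top s i} top≼))
  back-low : ∀ i → κ ∧ᶠ ◇ α ⊢ ◇ (θ (root i) 0F ∨ᶠ θ (root i) 1F)
  back-low 0F = ◇-keep four (weaken hit) ⨾ ◇-mono ∧-distrib-∨
  -- By `miss` one copy of the present world already fails `a`, so reflexivity provides the
  -- successor.
  back-low 1F = ◇-keep four (weaken (⊢-∧ ⊢-refl miss ⨾ ◇-intro))
    ⨾ ◇-mono (tautology 4 λ c m a b →
        c ∧ᶠ (m ∧ᶠ ¬ᶠ (a ∧ᶠ b)) ⇒ (c ∧ᶠ (m ∧ᶠ ¬ᶠ a)) ∨ᶠ (c ∧ᶠ (m ∧ᶠ ¬ᶠ b)))
  back : ∀ {w v} i → w ≼ v → θ w i ⊢ ◇ (θ v 0F ∨ᶠ θ v 1F)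
  back {root i} {root k}  j root≼ = θ⊢ i j ⨾ back-low k
  back {root i} {top _ _} j root≼ = θ⊢ i j ⨾ ∧-fst ⨾ T ⨾ ◇-mono ∨-inl
  back {top _ _} j top≼ = ∨-inl ⨾ ◇-intro

  bisimulation : Bisimulation lowPoint a θ
  bisimulation = record { atom = atom ; forth = forth ; back = back }

-- Classification of the additive formulas

-- A decision tree on the five truth values. After `⊤ᶠ` is split off, `crowd` separates the formulas
-- implied by `◇ □ ◇ var p` from `var p` and `⊥ᶠ`.
index : Formula → Fin 6
index φ =
  if holds φ (λ _ → false) (root 0F) then 3F else
  if holds φ crowd (root 0F)
  then (if holds φ lowPoint (root 1F) then 2F else
        if holds φ lowPoint (root 0F) then 5F else 4F)
  else (if holds φ (λ _ → true) (root 0F) then 1F else 0F)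

holds-cong : Equivalent S4 φ ψ → ∀ A w → holds φ A w ≡ holds ψ A w
holds-cong {φ} {ψ} φ⇔ψ A w with holds φ A w | holds ψ A w
  | ⇒-true-elim (holds φ A w) (force-sound (λ _ → A) (⇔-to φ⇔ψ) w)
  | ⇒-true-elim (holds ψ A w) (force-sound (λ _ → A) (⇔-from φ⇔ψ) w)
... | true  | _     | φ⇒ψ | _   = sym (φ⇒ψ refl)
... | false | false | _   | _   = refl
... | false | true  | _   | ψ⇒φ = ψ⇒φ refl

index-cong : Equivalent S4 φ ψ → index φ ≡ index ψ
index-cong φ⇔ψ
  rewrite holds-cong φ⇔ψ (λ _ → false) (root 0F) | holds-cong φ⇔ψ crowd (root 0F)
        | holds-cong φ⇔ψ lowPoint (root 1F) | holds-cong φ⇔ψ lowPoint (root 0F)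
        | holds-cong φ⇔ψ (λ _ → true) (root 0F) = refl

-- Evaluation on the finite frame; together with `index-cong` this makes the six formulas pairwise
-- inequivalent.
index-sixFormulas : ∀ p i → index (lookup (sixFormulas p) i) ≡ i
index-sixFormulas p 0F = refl
index-sixFormulas p 1F = refl
index-sixFormulas p 2F = refl
index-sixFormulas p 3F = refl
index-sixFormulas p 4F = refl
index-sixFormulas p 5F = refl

module Classification {p q φ} (p≢q : p ≢ q) (φ∈Fm : φ ∈ Fm p)
  (additive : Additive S4 p q φ) where

  π : Formula
  π = var p

  mono : ∀ {a b} → (∀ i → a i ⊢ b i) → ∀ i → ⟦ φ ⟧ a i ⊢ ⟦ φ ⟧ b i
  mono = ⟦⟧-mono p≢q φ∈Fm additive

  below : ∀ {a} → (∀ i → a i ⊢ π) → ∀ i → ⟦ φ ⟧ a i ⊢ φ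
  below = ⟦⟧-below p≢q φ∈Fm additive

  above : ∀ {a} → (∀ i → π ⊢ a i) → ∀ i → φ ⊢ ⟦ φ ⟧ a i
  above = ⟦⟧-above p≢q φ∈Fm additive

  split : ∀ {a b} → (∀ i → π ⊢ (a ∪ b) i) → ∀ i → φ ⊢ ⟦ φ ⟧ a i ∨ᶠ ⟦ φ ⟧ b i
  split {a} {b} h i = above h i ⨾ ⇔-to (⟦⟧-additive p≢q φ∈Fm additive a b i)

  split-copies : φ ⊢ ⟦ φ ⟧ ⟨ π , ⊥ᶠ ⟩ 0F ∨ᶠ ⟦ φ ⟧ ⟨ ⊥ᶠ , π ⟩ 0F
  split-copies = split (λ { 0F → ∨-inl ; 1F → ∨-inr }) 0F

  true-at-∅ : holds φ (λ _ → false) (root 0F) ≡ true → ⊤ᶠ ⊢ φ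
  true-at-∅ h =
    transfer-true {a = λ _ → ⊥ᶠ}
      (constant-bisimulation false ⊤-stable λ _ → ⊢-refl) φ (root 0F) 0F h
    ⨾ below (λ _ → ⊥⊢) 0F

  -- Where `□ ¬ᶠ π` holds, `π` is false from there on, which matches the empty valuation.
  false-at-∅ : holds φ (λ _ → false) (root 0F) ≡ false → φ ⊢ ◇ π
  false-at-∅ h = above (λ _ → ⊢-refl) 0F ⨾
    (tautology 2 (λ a b → (a ⇒ ¬ᶠ b) ⇒ b ⇒ ¬ᶠ a)
      · transfer-false {a = λ _ → π} (constant-bisimulation false four λ _ → T)
          φ (root 0F) 0F h)

  -- In `⟨ χ , ¬ᶠ χ ⟩` exactly one copy of each world is chosen, so the pair matches `crowd`, and
  -- `φ` can hold only at chosen copies. The halves of `split-copies` lie below the cases `χ = π`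
  -- and `χ = ⊥ᶠ`.
  false-at-crowd : holds φ crowd (root 0F) ≡ false → φ ⊢ π
  false-at-crowd h = split-copies ⨾ ∨-⊢
    (mono (λ { 0F → ⊢-refl ; 1F → ⊥⊢ }) 0F ⨾ outside π)
    (mono (λ { 0F → ⊢-refl ; 1F → ⊢⊤ }) 0F ⨾ outside ⊥ᶠ ⨾ ⊥⊢)
    where
    outside : ∀ χ → ⟦ φ ⟧ ⟨ χ , ¬ᶠ χ ⟩ 0F ⊢ χ
    outside χ = tautology 2 (λ f c → (⊤ᶠ ∧ᶠ ¬ᶠ c ⇒ ¬ᶠ f) ⇒ f ⇒ c)
      · transfer-false {a = ⟨ χ , ¬ᶠ χ ⟩}
          (crowd-bisimulation {⊤ᶠ} ⊤-stable
            (weaken (◇-intro · tautology 1 λ c → c ∨ᶠ ¬ᶠ c))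
            (weaken (◇-intro · tautology 1 λ c → ¬ᶠ c ∨ᶠ ¬ᶠ ¬ᶠ c)))
          φ (root 0F) 0F h

  full : ∀ {b} → holds φ (λ _ → true) (root 0F) ≡ b → ⊤ᶠ ⊢ sign b (⟦ φ ⟧ (λ _ → ⊤ᶠ) 0F)
  full refl = transfer
    (constant-bisimulation true ⊤-stable λ _ → ⊢-refl) φ (root 0F) 0F

  false-at-full : holds φ (λ _ → true) (root 0F) ≡ false → φ ⊢ ⊥ᶠ
  false-at-full h = tautology 2 (λ f g → (f ⇒ g) ⇒ (⊤ᶠ ⇒ ¬ᶠ g) ⇒ f ⇒ ⊥ᶠ)
    · above (λ _ → ⊢⊤) 0F · full h

  -- φ (π) ∨ φ (¬ π) is provable, and φ (¬ π) implies ¬ π.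
  true-at-full : holds φ (λ _ → true) (root 0F) ≡ true → φ ⊢ π → π ⊢ φ
  true-at-full h φ⊢π =
    tautology 4 (λ g f f′ c → (⊤ᶠ ⇒ g) ⇒ (g ⇒ f ∨ᶠ f′) ⇒ (f′ ⇒ ¬ᶠ c) ⇒ c ⇒ f)
      · full h
      · (mono (λ _ → tautology 1 λ c → ⊤ᶠ ⇒ c ∨ᶠ ¬ᶠ c) 0F
          ⨾ ⇔-to (⟦⟧-additive p≢q φ∈Fm additive (λ _ → π) (λ _ → ¬ᶠ π) 0F))
      · double-S4 (λ _ _ → ¬ᶠ π) φ⊢π 0F
    ⨾ below (λ _ → ⊢-refl) 0F

  -- The hypothesis yields `◇ e`. If `e` recurs forever, `⟨ e , ⊥ᶠ ⟩` matches `crowd`; otherwise it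
  -- matches `leftPoint` and its mirror image, and additivity makes `φ` true for one of them.
  true-at-crowd : holds φ crowd (root 0F) ≡ true → ◇ □ ◇ π ⊢ φ
  true-at-crowd h = ◇-mono (recurrent ⨾ T) ⨾ ◇◇ ⨾
    (tautology 3 (λ l u f → (u ⇒ f) ⇒ (l ∧ᶠ ¬ᶠ u ⇒ f) ⇒ l ⇒ f)
      · seen-from-above · lost-from-above)
    where
    e : Formula
    e = π ∧ᶠ □ ◇ π
    recurrent : □ ◇ π ⊢ □ ◇ e
    recurrent = tautology 2 (λ a b → (a ⇒ a ⇒ b) ⇒ a ⇒ b)
      · □-under four (◇-under four (tautology 2 λ c a → c ⇒ a ⇒ a ∧ᶠ c))
    stable : e ⊢ □ ◇ e
    stable = ∧-snd ⨾ recurrent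
    e⊢π : ∀ i → ⟨ e , ⊥ᶠ ⟩ i ⊢ π
    e⊢π 0F = ∧-fst
    e⊢π 1F = ⊥⊢
    seen-from-above : □ ◇ e ⊢ φ
    seen-from-above = ⊢-∧ ⊢-refl ⊢⊤
      -- In the second copy `e` is replaced by `⊥ᶠ`, so every world there matches a root world,
      -- where `crowd` is false.
      ⨾ transfer-true {a = ⟨ e , ⊥ᶠ ⟩}
          (crowd-bisimulation four (T ⨾ ◇-mono ∨-inl)
            (weaken (◇-intro · (∨-inr · ⊢-refl))))
          φ (root 0F) 1F h
      ⨾ below e⊢π 1F
    lost-from-above : ◇ e ∧ᶠ ◇ □ ¬ᶠ e ⊢ φ
    lost-from-above with holds φ leftPoint (root 0F) in eq
    ... | true  = transfer-true (LeftPoint.bisimulation stable) φ (root 0F) 0F eq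
                    ⨾ below e⊢π 0F
    ... | false = transfer-true (flip-bisimulation (LeftPoint.bisimulation stable))
                    φ (root 0F) 0F
                    (holds-additive p≢q φ∈Fm additive leftPoint (leftPoint ∘ flip)
                      (root 0F) h eq)
                    ⨾ below e⊢π 0F

  -- ¬ᶠ κ and ◇ □ ◇ π are the same formula once ◇ is unfolded.
  κ : Formula
  κ = □ ◇ □ ¬ᶠ π

  -- The pair in `first-copy` lies below `π` and gives lower bounds for `φ`. The other two pairs lie
  -- above the halves of `split-copies` and give upper bounds.
  first-copy = LowPoint.bisimulation {π} {⟨ π , ⊥ᶠ ⟩} (λ { 0F → ◇-intro ; 1F → ⊥⊢ })
    (◇-mono ∨-inl) (weaken (tautology 1 λ a → ¬ᶠ (a ∧ᶠ ⊥ᶠ)))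
  separated-copies = LowPoint.bisimulation {π} {⟨ π , ◇ π ∧ᶠ ¬ᶠ π ⟩}
    (λ { 0F → ◇-intro ; 1F → ∧-fst })
    (◇-mono ∨-inl) (weaken (tautology 2 λ a b → ¬ᶠ (a ∧ᶠ (b ∧ᶠ ¬ᶠ a))))
  second-copy = LowPoint.bisimulation {π} {⟨ ⊥ᶠ , ◇ π ⟩}
    (λ { 0F → ⊥⊢ ; 1F → ⊢-refl })
    (∨-inr ⨾ ◇-intro) (weaken (tautology 1 λ a → ¬ᶠ (⊥ᶠ ∧ᶠ a)))

  first-copy⊢π : ∀ i → ⟨ π , ⊥ᶠ ⟩ i ⊢ π
  first-copy⊢π 0F = ⊢-refl
  first-copy⊢π 1F = ⊥⊢

  true-beside-lowPoint : holds φ lowPoint (root 1F) ≡ true → ◇ □ ◇ π ⊢ φ → ◇ π ⊢ φ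
  true-beside-lowPoint h ◇□◇⊢φ =
    tautology 3 (λ k m f → (¬ᶠ k ⇒ f) ⇒ (k ∧ᶠ (m ∧ᶠ ⊤ᶠ) ⇒ f) ⇒ m ⇒ f)
      · ◇□◇⊢φ
      · (transfer-true first-copy φ (root 1F) 1F h ⨾ below first-copy⊢π 1F)

  true-at-lowPoint : holds φ lowPoint (root 0F) ≡ true → ◇ □ ◇ π ⊢ φ →
    ◇ □ ◇ π ∨ᶠ π ⊢ φ
  true-at-lowPoint h ◇□◇⊢φ =
    tautology 3 (λ k a f → (¬ᶠ k ⇒ f) ⇒ (k ∧ᶠ a ⇒ f) ⇒ ¬ᶠ k ∨ᶠ a ⇒ f)
      · ◇□◇⊢φ
      · (transfer-true first-copy φ (root 0F) 0F h ⨾ below first-copy⊢π 0F)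

  -- By `split-copies`, `φ` gives one of two halves. `χ` refutes the first; `second-copy` refutes
  -- the second under `κ`, since its first component is `⊥ᶠ` and such worlds match `root 1F`.
  refute-copies : φ ⊢ ◇ π → holds φ lowPoint (root 1F) ≡ false →
    ∀ {χ} → χ ⊢ ¬ᶠ ⟦ φ ⟧ ⟨ π , ◇ π ∧ᶠ ¬ᶠ π ⟩ 0F → φ ⊢ ¬ᶠ (κ ∧ᶠ χ)
  refute-copies φ⊢m h d =
    tautology 6 (λ f m k x f₁ f₂ → (f ⇒ m) ⇒ (f ⇒ f₁ ∨ᶠ f₂) ⇒ (x ⇒ ¬ᶠ f₁)
        ⇒ (k ∧ᶠ (m ∧ᶠ ⊤ᶠ) ⇒ ¬ᶠ f₂) ⇒ f ⇒ ¬ᶠ (k ∧ᶠ x))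
      · φ⊢m · (split-copies ⨾ ∨-⊢
          (mono (λ { 0F → ⊢-refl ; 1F → ⊥⊢ }) 0F ⨾ ∨-inl)
          (mono (λ { 0F → ⊢-refl ; 1F → ◇-intro }) 0F ⨾ ∨-inr))
      · d · transfer-false second-copy φ (root 1F) 0F h

  false-beside-lowPoint : φ ⊢ ◇ π → holds φ lowPoint (root 1F) ≡ false →
    φ ⊢ ◇ □ ◇ π ∨ᶠ π
  false-beside-lowPoint φ⊢m h =
    tautology 4 (λ f m k a → (f ⇒ m)
        ⇒ (f ⇒ ¬ᶠ (k ∧ᶠ (k ∧ᶠ (m ∧ᶠ ¬ᶠ a)))) ⇒ f ⇒ ¬ᶠ k ∨ᶠ a)
      · φ⊢m
      · refute-copies φ⊢m h (transfer-false separated-copies φ (root 1F) 0F h)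

  false-at-lowPoint : φ ⊢ ◇ π → holds φ lowPoint (root 1F) ≡ false →
    holds φ lowPoint (root 0F) ≡ false → φ ⊢ ◇ □ ◇ π
  false-at-lowPoint φ⊢m h₁ h₀ =
    tautology 3 (λ f k a → (f ⇒ ¬ᶠ k ∨ᶠ a)
        ⇒ (f ⇒ ¬ᶠ (k ∧ᶠ (k ∧ᶠ a))) ⇒ f ⇒ ¬ᶠ k)
      · false-beside-lowPoint φ⊢m h₁
      · refute-copies φ⊢m h₁ (transfer-false separated-copies φ (root 0F) 0F h₀)

  classified : Equivalent S4 φ (lookup (sixFormulas p) (index φ))
  classified with holds φ (λ _ → false) (root 0F) in e∅
  ... | true = ⇔-intro ⊢⊤ (true-at-∅ e∅)
  ... | false with holds φ crowd (root 0F) in ec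
  ...   | true with holds φ lowPoint (root 1F) in e₁
  ...     | true = ⇔-intro (false-at-∅ e∅) (true-beside-lowPoint e₁ (true-at-crowd ec))
  ...     | false with holds φ lowPoint (root 0F) in e₀
  ...       | true = ⇔-intro (false-beside-lowPoint (false-at-∅ e∅) e₁)
                       (true-at-lowPoint e₀ (true-at-crowd ec))
  ...       | false = ⇔-intro (false-at-lowPoint (false-at-∅ e∅) e₁ e₀) (true-at-crowd ec)
  classified | false | false with holds φ (λ _ → true) (root 0F) in ef
  ... | true  = ⇔-intro (false-at-crowd ec) (true-at-full ef (false-at-crowd ec))
  ... | false = ⇔-intro (false-at-full ef) ⊥⊢

-- Additivity and normality of the six formulas

◇-∨ : ◇ (α ∨ᶠ β) ⊢ ◇ α ∨ᶠ ◇ β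
◇-∨ = tautology 3 (λ a b c → (a ⇒ b ⇒ c) ⇒ ¬ᶠ c ⇒ ¬ᶠ a ∨ᶠ ¬ᶠ b)
  · (□-mono (tautology 2 λ a b → ¬ᶠ a ⇒ ¬ᶠ b ⇒ ¬ᶠ (a ∨ᶠ b)) ⨾ K)

-- If □ ◇ (α ∨ β) but ¬ ◇ □ ◇ α, then worlds satisfying □ ¬ α are always ahead, and
-- ◇ β holds there.
□◇-∨ : □ ◇ (α ∨ᶠ β) ⊢ ◇ □ ◇ α ∨ᶠ ◇ □ ◇ β
□◇-∨ {α} {β} =
  tautology 4 (λ w k b d → (w ⇒ k ⇒ b) ⇒ (b ⇒ d) ⇒ w ⇒ ¬ᶠ k ∨ᶠ d)
    · (four ⨾ □-mono (◇-under four ahead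
        ⨾ tautology 3 (λ a b c → (b ⇒ c) ⇒ (a ⇒ b) ⇒ a ⇒ c) · ◇◇) ⨾ K)
    · ◇-intro
  where
  ahead : □ ◇ (α ∨ᶠ β) ⊢ □ ¬ᶠ α ⇒ ◇ β
  ahead = T ⨾ ◇-∨ ⨾ tautology 2 λ n b → ¬ᶠ n ∨ᶠ b ⇒ n ⇒ b

◇□◇-∨ : Equivalent S4 (◇ □ ◇ (α ∨ᶠ β)) (◇ □ ◇ α ∨ᶠ ◇ □ ◇ β)
◇□◇-∨ = ⇔-intro
  (◇-mono □◇-∨ ⨾ ◇-∨ ⨾ ∨-⊢ (◇◇ ⨾ ∨-inl) (◇◇ ⨾ ∨-inr))
  (∨-⊢ (◇-mono (□-mono (◇-mono ∨-inl))) (◇-mono (□-mono (◇-mono ∨-inr))))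

sixFormulas-additive : ∀ p q i → Additive S4 p q (lookup (sixFormulas p) i)
sixFormulas-additive p q 0F = ⇔-intro ∨-inl (∨-⊢ ⊢-refl ⊢-refl)
sixFormulas-additive p q 1F rewrite dec-true (p ≟ p) refl = ⇔-intro ⊢-refl ⊢-refl
sixFormulas-additive p q 2F rewrite dec-true (p ≟ p) refl =
  ⇔-intro ◇-∨ (∨-⊢ (◇-mono ∨-inl) (◇-mono ∨-inr))
sixFormulas-additive p q 3F = ⇔-intro ∨-inl (∨-⊢ ⊢-refl ⊢-refl)
sixFormulas-additive p q 4F rewrite dec-true (p ≟ p) refl = ◇□◇-∨
sixFormulas-additive p q 5F rewrite dec-true (p ≟ p) refl =
  tautology 5 (λ m a b c d →
    (m ⇔ᶠ (a ∨ᶠ b)) ⇒ ((m ∨ᶠ (c ∨ᶠ d)) ⇔ᶠ ((a ∨ᶠ c) ∨ᶠ (b ∨ᶠ d)))) · ◇□◇-∨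

◇⊥ : ◇ ⊥ᶠ ⊢ ⊥ᶠ
◇⊥ = tautology 1 (λ a → a ⇒ ¬ᶠ ¬ᶠ a) · nec ⊢-refl

◇□◇⊥ : ◇ □ ◇ ⊥ᶠ ⊢ ⊥ᶠ
◇□◇⊥ = ◇-mono (T ⨾ ◇⊥) ⨾ ◇⊥

sixFormulas-normal : ∀ p i → NormalIn S4 p (lookup (sixFormulas p) i) ⇔
  (lookup (sixFormulas p) i ≢ ⊤ᶠ)
sixFormulas-normal p 0F = mk⇔ (λ _ ()) λ _ → ⇔-intro ⊢-refl ⊢-refl
sixFormulas-normal p 1F rewrite dec-true (p ≟ p) refl =
  mk⇔ (λ _ ()) λ _ → ⇔-intro ⊢-refl ⊢-refl
sixFormulas-normal p 2F rewrite dec-true (p ≟ p) refl =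
  mk⇔ (λ _ ()) λ _ → ⇔-intro ◇⊥ ⊥⊢
sixFormulas-normal p 3F =
  -- Normality of `⊤ᶠ` would make `⊤ᶠ` equivalent to `⊥ᶠ`, which soundness on the frame excludes.
  mk⇔ (λ e _ → contradiction (force-sound (λ _ _ → false) e (root 0F)) λ ())
    λ ≢⊤ → contradiction refl ≢⊤
sixFormulas-normal p 4F rewrite dec-true (p ≟ p) refl =
  mk⇔ (λ _ ()) λ _ → ⇔-intro ◇□◇⊥ ⊥⊢
sixFormulas-normal p 5F rewrite dec-true (p ≟ p) refl =
  mk⇔ (λ _ ()) λ _ → ⇔-intro (∨-⊢ ◇□◇⊥ ⊢-refl) ⊥⊢

◇-Fm : ∀ {p} → φ ∈ Fm p → ◇ φ ∈ Fm p
◇-Fm f = (□ (f ⇒ ⊥ᶠ)) ⇒ ⊥ᶠ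

sixFormulas-Fm : ∀ p i → lookup (sixFormulas p) i ∈ Fm p
sixFormulas-Fm p 0F = ⊥ᶠ
sixFormulas-Fm p 1F = var
sixFormulas-Fm p 2F = ◇-Fm var
sixFormulas-Fm p 3F = ⊥ᶠ ⇒ ⊥ᶠ
sixFormulas-Fm p 4F = ◇-Fm (□ ◇-Fm var)
sixFormulas-Fm p 5F = (◇-Fm (□ ◇-Fm var) ⇒ ⊥ᶠ) ⇒ var

theorem6p8 : (p q : Var) → p ≢ q →
    let ψ : Fin 6 → Formula
        ψ = lookup (sixFormulas p)
    in (∀ i → (ψ i ∈ Fm p) × Additive S4 p q (ψ i))
       × (∀ i j → Equivalent S4 (ψ i) (ψ j) → i ≡ j)
       × (∀ φ → φ ∈ Fm p → Additive S4 p q φ → ∃ λ i → Equivalent S4 φ (ψ i))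
       × (∀ i → NormalIn S4 p (ψ i) ⇔ (ψ i ≢ ⊤ᶠ))
theorem6p8 p q p≢q =
    (λ i → sixFormulas-Fm p i , sixFormulas-additive p q i)
  , (λ i j e → trans (sym (index-sixFormulas p i))
      (trans (index-cong e) (index-sixFormulas p j)))
  , (λ φ φ∈Fm additive → index φ , Classification.classified p≢q φ∈Fm additive)
  , sixFormulas-normal p
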